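{- Let $X$ be a Polish $\mathbb{Z}$-space and let $T:X\to X$ be the homeomorphism given by the action of $1\in\mathbb{Z}$. Suppose that for every nonempty open $V\subseteq X$ there exists $d\ge 1$ such that for every $l\ge 1$ there is a $d$-syndetic set $F\subseteq\mathbb{Z}$ of length at least $l$ with $\bigcap_{n\in F}T^n(V)\neq\emptyset$. Then $X$ does not admit a non-meager Baire measurable weakly wandering subset.
   Context: A Polish $\mathbb{Z}$-space is a Polish space equipped with a continuous action of $\mathbb{Z}$. For $d\ge1$, a finite set $F=\{n_0<n_1<\dots<n_{k-1}\}\subseteq\mathbb{Z}$ is $d$-syndetic if $n_{i+1}-n_i\le d$ for all $i<k-1$; its length is $n_{k-1}-n_0$. A set $A\subseteq X$ is weakly wandering if there is an infinite set $H\subseteq\mathbb{Z}$ such that $T^h(A)\cap T^{h'}(A)=\emptyset$ for all distinct $h,h'\in H$. A set is Baire measurable if it has the Baire property. -}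

module Defs where

open import Data.Fin.Base as Fin using (Fin; inject₁; fromℕ)
open import Data.Integer.Base as ℤ using (ℤ; +_; -[1+_]; 0ℤ; 1ℤ; -1ℤ)
open import Data.List.Base using (List)
import Data.List.Membership.Propositional as List
open import Data.Maybe.Base using (Maybe; just)
open import Data.Nat.Base as ℕ using (ℕ; suc)
import Data.Nat.Tactic.RingSolver as ℕ-Ring
open import Data.Product.Base using (Σ-syntax; ∃-syntax; _×_)
open import Data.Rational.Base as ℚ using (ℚ; 0ℚ)
import Data.Rational.Properties as ℚ
open import Data.Rational.Solver using (module +-*-Solver)
import Data.Rational.Unnormalised.Base as ℚᵘ
import Data.Rational.Unnormalised.Properties as ℚᵘ
open import Data.Unit.Polymorphic.Base using (⊤)
open import Function.Bundles using (_⇔_)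
open import Function.Endo.Propositional using (_^_)
open import Function.Metric.Structures using (IsGeneralMetric)
open import Level using (Level; 0ℓ)
open import Relation.Binary.Bundles using (Setoid)
open import Relation.Binary.Core using (Rel; _Preserves_⟶_)
open import Relation.Binary.Definitions using (_Respects_)
open import Relation.Binary.PropositionalEquality.Core using (_≡_; _≢_; refl; cong; cong₂)
open import Relation.Nullary.Negation.Core using (¬_)
open import Relation.Unary
  using (Pred; _∈_; _⊆_; _≐_; _≬_; Empty; Satisfiable; ∁; _∩_; _∪_; _∖_; ⋃; _⊢_)

private
  variable
    a p q : Level

infixl 6 _+ᴿ_
infix  4 _≤ᴿ_ _<ᴿ_ _≃ᴿ_

-- The bound 1/n of Bishop's definitions, with n shifted to start from 0.
1/1+_ : ℕ → ℚ
1/1+ n = + 1 ℚ./ suc n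

-- Bishop's reals: regular sequences of rationals.
record ℝ : Set where
  field
    seq     : ℕ → ℚ
    regular : ∀ m n → ℚ.∣ seq m ℚ.- seq n ∣ ℚ.≤ (1/1+ m) ℚ.+ (1/1+ n)

open ℝ public

_≤ᴿ_ : Rel ℝ 0ℓ
x ≤ᴿ y = ∀ n → seq x n ℚ.≤ seq y n ℚ.+ ((1/1+ n) ℚ.+ (1/1+ n))

_<ᴿ_ : Rel ℝ 0ℓ
x <ᴿ y = ∃[ n ] seq x n ℚ.+ ((1/1+ n) ℚ.+ (1/1+ n)) ℚ.< seq y n

-- That is, ∣ xₙ - yₙ ∣ ≤ 2/(n+1) for all n.
_≃ᴿ_ : Rel ℝ 0ℓ
x ≃ᴿ y = x ≤ᴿ y × y ≤ᴿ x

1/1+-half : ∀ n → (1/1+ suc (n ℕ.+ n)) ℚ.+ (1/1+ suc (n ℕ.+ n)) ≡ 1/1+ n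
1/1+-half n = ℚ.toℚᵘ-injective (begin
  ℚ.toℚᵘ ((1/1+ m) ℚ.+ (1/1+ m))            ≈⟨ ℚ.toℚᵘ-homo-+ (1/1+ m) (1/1+ m) ⟩
  ℚ.toℚᵘ (1/1+ m) ℚᵘ.+ ℚ.toℚᵘ (1/1+ m)      ≈⟨ ℚᵘ.+-cong (ℚ.toℚᵘ-fromℚᵘ u) (ℚ.toℚᵘ-fromℚᵘ u) ⟩
  u ℚᵘ.+ u                                  ≈⟨ ℚᵘ.*≡* (cong +_ (eq n)) ⟩
  ℚᵘ.mkℚᵘ (+ 1) n                           ≈⟨ ℚᵘ.≃-sym (ℚ.toℚᵘ-fromℚᵘ (ℚᵘ.mkℚᵘ (+ 1) n)) ⟩
  ℚ.toℚᵘ (1/1+ n)                           ∎)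
  where
  m = suc (n ℕ.+ n)
  u = ℚᵘ.mkℚᵘ (+ 1) m
  open import Relation.Binary.Reasoning.Setoid ℚᵘ.≃-setoid
  eq : ∀ n → (1 ℕ.* suc (suc (n ℕ.+ n)) ℕ.+ 1 ℕ.* suc (suc (n ℕ.+ n))) ℕ.* suc n
           ≡ 1 ℕ.* (suc (suc (n ℕ.+ n)) ℕ.* suc (suc (n ℕ.+ n)))
  eq = ℕ-Ring.solve-∀

_+ᴿ_ : ℝ → ℝ → ℝ
x +ᴿ y = record
  { seq     = λ n → seq x (dbl n) ℚ.+ seq y (dbl n)
  ; regular = λ m n → reg m n
  }
  where
  dbl : ℕ → ℕ
  dbl n = suc (n ℕ.+ n)
  open ℚ.≤-Reasoning
  open +-*-Solver
  reg : ∀ m n →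
    ℚ.∣ (seq x (dbl m) ℚ.+ seq y (dbl m)) ℚ.- (seq x (dbl n) ℚ.+ seq y (dbl n)) ∣
      ℚ.≤ (1/1+ m) ℚ.+ (1/1+ n)
  reg m n = begin
    ℚ.∣ (xm ℚ.+ ym) ℚ.- (xn ℚ.+ yn) ∣
      ≡⟨ cong ℚ.∣_∣ (solve 4 (λ x y z w → (x :+ y) :- (z :+ w) := (x :- z) :+ (y :- w)) refl xm ym xn yn) ⟩
    ℚ.∣ (xm ℚ.- xn) ℚ.+ (ym ℚ.- yn) ∣
      ≤⟨ ℚ.∣p+q∣≤∣p∣+∣q∣ (xm ℚ.- xn) (ym ℚ.- yn) ⟩
    ℚ.∣ xm ℚ.- xn ∣ ℚ.+ ℚ.∣ ym ℚ.- yn ∣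
      ≤⟨ ℚ.+-mono-≤ (regular x (dbl m) (dbl n)) (regular y (dbl m) (dbl n)) ⟩
    (i ℚ.+ j) ℚ.+ (i ℚ.+ j)
      ≡⟨ solve 2 (λ i j → (i :+ j) :+ (i :+ j) := (i :+ i) :+ (j :+ j)) refl i j ⟩
    (i ℚ.+ i) ℚ.+ (j ℚ.+ j)
      ≡⟨ cong₂ ℚ._+_ (1/1+-half m) (1/1+-half n) ⟩
    (1/1+ m) ℚ.+ (1/1+ n) ∎
    where
    xm = seq x (dbl m)
    ym = seq y (dbl m)
    xn = seq x (dbl n)
    yn = seq y (dbl n)
    i = 1/1+ (dbl m)
    j = 1/1+ (dbl n)

0ᴿ : ℝ
0ᴿ = record
  { seq     = λ _ → 0ℚ
  ; regular = λ m n → ℚ.+-mono-≤ (0≤1/1+ m) (0≤1/1+ n)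
  }
  where
  0≤1/1+ : ∀ n → 0ℚ ℚ.≤ 1/1+ n
  0≤1/1+ n = ℚ.<⇒≤ (ℚ.positive⁻¹ (1/1+ n) {{ℚ.normalize-pos 1 (suc n)}})

-- The points form a setoid, whose equality plays the role of equality
-- of points; a set of points is a predicate.
record TopologicalSpace (a : Level) : Set (Level.suc a) where
  field
    setoid : Setoid a a

  open Setoid setoid public

  field
    Open      : Pred (Pred Carrier a) a
    Open-resp : ∀ {U} → Open U → U Respects _≈_
    Open-ext  : ∀ {U V} → U ≐ V → Open U → Open V
    Open-⊤    : Open (λ _ → ⊤)
    Open-∩    : ∀ {U V} → Open U → Open V → Open (U ∩ V)
    Open-⋃    : (I : Set a) (U : I → Pred Carrier a) →
                (∀ i → Open (U i)) → Open (⋃ I U)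

  Interior : Pred Carrier p → Pred Carrier _
  Interior S x = ∃[ U ] Open U × x ∈ U × U ⊆ S

  Dense : Pred Carrier p → Set _
  Dense D = ∀ U → Open U → Satisfiable U → U ≬ D

  -- Positive form of "the closure of N has empty interior": the
  -- complement of the closure, i.e. the interior of ∁ N, is dense.
  NowhereDense : Pred Carrier p → Set _
  NowhereDense N = Dense (Interior (∁ N))

  Meager : Pred Carrier a → Set _
  Meager M = Σ[ N ∈ (ℕ → Pred Carrier a) ] (∀ n → NowhereDense (N n)) × M ≐ ⋃ ℕ N

  _△_ : Pred Carrier a → Pred Carrier a → Pred Carrier a
  P △ Q = (P ∖ Q) ∪ (Q ∖ P)

  BaireMeasurable : Pred Carrier a → Set _
  BaireMeasurable A = ∃[ U ] Open U × Meager (A △ U)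

  Continuous : (Carrier → Carrier) → Set _
  Continuous f = ∀ U → Open U → Open (f ⊢ U)

  -- Partial enumerations, so that the empty space is separable.
  Separable : Set _
  Separable = Σ[ s ∈ (ℕ → Maybe Carrier) ] Dense (λ x → ∃[ n ] s n ≡ just x)

  image : (Carrier → Carrier) → Pred Carrier p → Pred Carrier _
  image f S y = ∃[ x ] x ∈ S × y ≈ f x

module _ (X : TopologicalSpace a) where
  open TopologicalSpace X

  module _ (d : Carrier → Carrier → ℝ) where

    MetricOpen : Pred Carrier p → Set _
    MetricOpen U = ∀ x → x ∈ U → ∃[ ε ] 0ᴿ <ᴿ ε × (∀ y → d x y <ᴿ ε → y ∈ U)

    Cauchy : (ℕ → Carrier) → Set
    Cauchy s = ∀ ε → 0ᴿ <ᴿ ε → ∃[ N ] ∀ m n → N ℕ.≤ m → N ℕ.≤ n → d (s m) (s n) <ᴿ ε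

    _ConvergesTo_ : (ℕ → Carrier) → Carrier → Set
    s ConvergesTo x = ∀ ε → 0ᴿ <ᴿ ε → ∃[ N ] ∀ n → N ℕ.≤ n → d (s n) x <ᴿ ε

    Complete : Set a
    Complete = ∀ s → Cauchy s → ∃[ x ] s ConvergesTo x

  record IsCompletelyMetrizable : Set (Level.suc a) where
    field
      d        : Carrier → Carrier → ℝ
      isMetric : IsGeneralMetric _≈_ _≃ᴿ_ _≤ᴿ_ 0ᴿ _+ᴿ_ d
      induces  : ∀ U → Open U ⇔ MetricOpen d U
      complete : Complete d

  record IsPolish : Set (Level.suc a) where
    field
      separable              : Separable
      isCompletelyMetrizable : IsCompletelyMetrizable

Infinite : Pred ℤ p → Set _
Infinite H = ¬ (Σ[ hs ∈ List ℤ ] H ⊆ (List._∈ hs))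

-- A nonempty finite set { n₀ < n₁ < ⋯ < nₖ₋₁ }, given by its increasing
-- enumeration; here k = suc size-1.
record FiniteSet : Set where
  field
    size-1     : ℕ
    elem       : Fin (suc size-1) → ℤ
    increasing : ∀ (i : Fin size-1) → elem (inject₁ i) ℤ.< elem (Fin.suc i)

  length : ℤ
  length = elem (fromℕ size-1) ℤ.- elem Fin.zero

  Syndetic : ℕ → Set
  Syndetic d = ∀ (i : Fin size-1) → elem (Fin.suc i) ℤ.- elem (inject₁ i) ℤ.≤ + d

record PolishℤSpace (a : Level) : Set (Level.suc a) where
  field
    space    : TopologicalSpace a
    isPolish : IsPolish space

  open TopologicalSpace space public

  infixr 7 _·_
  field
    _·_        : ℤ → Carrier → Carrier
    ·-cong     : ∀ n → (n ·_) Preserves _≈_ ⟶ _≈_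
    ·-identity : ∀ x → 0ℤ · x ≈ x
    ·-action   : ∀ m n x → (m ℤ.+ n) · x ≈ m · n · x
    -- Joint continuity of ℤ × X → X, as ℤ is discrete.
    continuous : ∀ n → Continuous (n ·_)

  T T⁻¹ : Carrier → Carrier
  T   = 1ℤ ·_
  T⁻¹ = -1ℤ ·_

  T^ : ℤ → Carrier → Carrier
  T^ (+ n)    = _^_ Carrier T n
  T^ -[1+ n ] = _^_ Carrier T⁻¹ (suc n)

  WeaklyWandering : Pred Carrier a → Set _
  WeaklyWandering A = Σ[ H ∈ Pred ℤ a ] Infinite H ×
    (∀ h h′ → h ∈ H → h′ ∈ H → h ≢ h′ → Empty (image (T^ h) A ∩ image (T^ h′) A))

{-# OPTIONS --safe #-}

-- Let A be non-meager and equal to the open set U modulo a meager set, and suppose the translates of A by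
-- the infinite set H are disjoint. Take a d-syndetic F, long compared with d + 1 elements of H, such that the
-- translates of U by F have a common point. Each of the d + 1 shifts of F by these elements meets a fixed
-- window of d consecutive integers, so f + h = f′ + h′ for some f, f′ ∈ F and distinct h, h′ ∈ H, and hence
-- T^h(U) meets T^h′(U). The intersection is open, so by the Baire category theorem T^h(A) meets T^h′(A).
-- The theorem is a negation, so it suffices to obtain U ≠ ∅, the elements of H and membership in A
-- up to double negation.
module Submission where

open import Defs
open import Data.Fin.Base as Fin using (Fin; inject₁; fromℕ; fromℕ<)
import Data.Fin.Properties as Fin
open import Data.Integer.Base as ℤ using (ℤ; +_; -[1+_]; 0ℤ; 1ℤ; -1ℤ)
import Data.Integer.Properties as ℤ
import Data.Integer.Tactic.RingSolver as ℤ-Ring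
import Data.List.Base as List
open import Data.List.Membership.DecPropositional ℤ._≟_ using (_∈?_)
import Data.List.Membership.Propositional as List
open import Data.List.Membership.Propositional.Properties using (∈-tabulate⁺)
open import Data.Nat.Base as ℕ using (ℕ; zero; suc; s≤s; _⊔_)
import Data.Nat.Properties as ℕ
open import Data.Product.Base using (Σ-syntax; ∃-syntax; _×_; _,_; proj₁; proj₂; map)
open import Data.Rational.Base as ℚ using (ℚ; mkℚ; 0ℚ; *<*)
import Data.Rational.Properties as ℚ
open import Data.Rational.Solver using (module +-*-Solver)
import Data.Rational.Unnormalised.Base as ℚᵘ
import Data.Rational.Unnormalised.Properties as ℚᵘ
open import Data.Sum.Base using (inj₁; inj₂)
open import Function.Base using (_∘_; id; case_of_)
open import Function.Bundles using (Equivalence)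
open import Function.Metric.Structures using (module IsGeneralMetric)
open import Level using (Level)
open import Relation.Binary.Definitions using (_Respects_)
open import Relation.Binary.PropositionalEquality.Core
  using (_≡_; _≢_; refl; sym; trans; cong; subst)
open import Relation.Nullary.Decidable.Core using (yes; no; decidable-stable)
open import Relation.Nullary.Negation.Core using (¬_; contradiction)
open import Relation.Unary
  using (Pred; _∈_; _∉_; _⊆_; Satisfiable; Empty; _∩_; _∪_; ⋂; _⊢_)

private variable
  a p : Level

-- Rational bounds and comparisons of Bishop reals.

1/1+-pos : ∀ n → 0ℚ ℚ.< 1/1+ n
1/1+-pos n = ℚ.positive⁻¹ (1/1+ n) {{ℚ.normalize-pos 1 (suc n)}}

1/1+-double-pos : ∀ n → 0ℚ ℚ.< (1/1+ n) ℚ.+ (1/1+ n)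
1/1+-double-pos n = ℚ.+-mono-< {0ℚ} {1/1+ n} {0ℚ} {1/1+ n} (1/1+-pos n) (1/1+-pos n)

toℚᵘ-1/1+ : ∀ n → ℚ.toℚᵘ (1/1+ n) ℚᵘ.≃ ℚᵘ.mkℚᵘ (+ 1) n
toℚᵘ-1/1+ n = ℚ.toℚᵘ-fromℚᵘ (ℚᵘ.mkℚᵘ (+ 1) n)

1/1+-antitone : ∀ {m n} → m ℕ.≤ n → 1/1+ n ℚ.≤ 1/1+ m
1/1+-antitone {m} {n} m≤n = ℚ.toℚᵘ-cancel-≤ (begin
  ℚ.toℚᵘ (1/1+ n)     ≃⟨ toℚᵘ-1/1+ n ⟩
  ℚᵘ.mkℚᵘ (+ 1) n     ≤⟨ ℚᵘ.*≤* (ℤ.+≤+ (ℕ.*-monoʳ-≤ 1 (s≤s m≤n))) ⟩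
  ℚᵘ.mkℚᵘ (+ 1) m     ≃⟨ toℚᵘ-1/1+ m ⟨
  ℚ.toℚᵘ (1/1+ m)     ∎)
  where open ℚᵘ.≤-Reasoning

-- On indices: 1/1+ half n is half of 1/1+ n.
half : ℕ → ℕ
half n = suc (n ℕ.+ n)

1/1+-half< : ∀ n → 1/1+ half n ℚ.< 1/1+ n
1/1+-half< n = begin-strict
  1/1+ half n                      ≡⟨ ℚ.+-identityʳ _ ⟨
  (1/1+ half n) ℚ.+ 0ℚ             <⟨ ℚ.+-monoʳ-< (1/1+ half n) (1/1+-pos (half n)) ⟩
  (1/1+ half n) ℚ.+ (1/1+ half n)  ≡⟨ 1/1+-half n ⟩
  1/1+ n                           ∎
  where open ℚ.≤-Reasoning

-- A positive fraction has numerator at least 1, so its own denominator supplies the index.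
1/1+-archimedean : ∀ {r} → 0ℚ ℚ.< r → ∃[ k ] 1/1+ k ℚ.≤ r
1/1+-archimedean {r@(mkℚ (+ suc a) k _)} _ = k , ℚ.toℚᵘ-cancel-≤ (begin
  ℚ.toℚᵘ (1/1+ k)         ≃⟨ toℚᵘ-1/1+ k ⟩
  ℚᵘ.mkℚᵘ (+ 1) k         ≤⟨ ℚᵘ.*≤* (ℤ.+≤+ (ℕ.*-monoˡ-≤ (suc k) (s≤s (ℕ.z≤n {a})))) ⟩
  ℚᵘ.mkℚᵘ (+ suc a) k     ∎)
  where open ℚᵘ.≤-Reasoning
1/1+-archimedean {mkℚ (+ 0) _ _} (*<* (ℤ.+<+ ()))
1/1+-archimedean {mkℚ ℤ.-[1+ _ ] _ _} (*<* ())

archimedean : ∀ {p q} → p ℚ.< q → ∃[ k ] p ℚ.+ (1/1+ k) ℚ.≤ q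
archimedean {p} {q} p<q = k , (begin
  p ℚ.+ (1/1+ k)        ≤⟨ ℚ.+-monoʳ-≤ p 1/1+k≤q-p ⟩
  p ℚ.+ (q ℚ.- p)       ≡⟨ solve 2 (λ p q → p :+ (q :- p) := q) refl p q ⟩
  q                     ∎)
  where
  open ℚ.≤-Reasoning
  open +-*-Solver
  gap = 1/1+-archimedean (subst (ℚ._< q ℚ.- p) (ℚ.+-inverseʳ p) (ℚ.+-monoˡ-< (ℚ.- p) p<q))
  k = proj₁ gap
  1/1+k≤q-p = proj₂ gap

regular≤ : ∀ x m n → seq x m ℚ.≤ seq x n ℚ.+ ((1/1+ m) ℚ.+ (1/1+ n))
regular≤ x m n = begin
  seq x m                                      ≡⟨ solve 2 (λ p q → p := q :+ (p :- q)) refl (seq x m) (seq x n) ⟩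
  seq x n ℚ.+ (seq x m ℚ.- seq x n)            ≤⟨ ℚ.+-monoʳ-≤ (seq x n) (ℚ.≤-trans (p≤∣p∣ _) (regular x m n)) ⟩
  seq x n ℚ.+ ((1/1+ m) ℚ.+ (1/1+ n))          ∎
  where
  open ℚ.≤-Reasoning
  open +-*-Solver
  p≤∣p∣ : ∀ p → p ℚ.≤ ℚ.∣ p ∣
  p≤∣p∣ (mkℚ (+ _) _ _)       = ℚ.≤-refl
  p≤∣p∣ (mkℚ ℤ.-[1+ _ ] _ _)  = ℚ.*≤* ℤ.-≤+

const : ℚ → ℝ
const q = record
  { seq     = λ _ → q
  ; regular = λ m n → subst (ℚ._≤ (1/1+ m) ℚ.+ (1/1+ n)) (cong ℚ.∣_∣ (sym (ℚ.+-inverseʳ q)))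
                (ℚ.<⇒≤ (ℚ.+-mono-< (1/1+-pos m) (1/1+-pos n)))
  }

const-mono : ∀ {p q} → p ℚ.≤ q → const p ≤ᴿ const q
const-mono {p} {q} p≤q n = begin
  p                                     ≤⟨ p≤q ⟩
  q                                     ≡⟨ ℚ.+-identityʳ q ⟨
  q ℚ.+ 0ℚ                              ≤⟨ ℚ.+-monoʳ-≤ q (ℚ.<⇒≤ (1/1+-double-pos n)) ⟩
  q ℚ.+ ((1/1+ n) ℚ.+ (1/1+ n))         ∎
  where open ℚ.≤-Reasoning

+ᴿ-mono-const : ∀ {x y p q} → x ≤ᴿ const p → y ≤ᴿ const q → (x +ᴿ y) ≤ᴿ const (p ℚ.+ q)
+ᴿ-mono-const {x} {y} {p} {q} x≤p y≤q n = begin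
  seq x (half n) ℚ.+ seq y (half n)         ≤⟨ ℚ.+-mono-≤ (x≤p (half n)) (y≤q (half n)) ⟩
  (p ℚ.+ (u ℚ.+ u)) ℚ.+ (q ℚ.+ (u ℚ.+ u))   ≡⟨ solve 3 (λ p q w → (p :+ w) :+ (q :+ w) := (p :+ q) :+ (w :+ w)) refl p q (u ℚ.+ u) ⟩
  (p ℚ.+ q) ℚ.+ ((u ℚ.+ u) ℚ.+ (u ℚ.+ u))   ≡⟨ cong (λ w → (p ℚ.+ q) ℚ.+ (w ℚ.+ w)) (1/1+-half n) ⟩
  (p ℚ.+ q) ℚ.+ ((1/1+ n) ℚ.+ (1/1+ n))     ∎
  where
  open ℚ.≤-Reasoning
  open +-*-Solver
  u = 1/1+ half n

-- The inequality is known at the single index n, with margin 2u. Regularity moves both sides to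
-- index m at a cost of 2u + 2v, and the margin pays for 2u of it.
<ᴿ⇒≤ᴿ : ∀ {x y} → x <ᴿ y → x ≤ᴿ y
<ᴿ⇒≤ᴿ {x} {y} (n , x<y) m = begin
  seq x m                                                         ≤⟨ regular≤ x m n ⟩
  seq x n ℚ.+ (v ℚ.+ u)                                           ≡⟨ solve 3 (λ x u v → x :+ (v :+ u) := (x :+ (u :+ u)) :+ (v :- u)) refl (seq x n) u v ⟩
  (seq x n ℚ.+ (u ℚ.+ u)) ℚ.+ (v ℚ.- u)                           ≤⟨ ℚ.+-monoˡ-≤ (v ℚ.- u) (ℚ.<⇒≤ x<y) ⟩
  seq y n ℚ.+ (v ℚ.- u)                                           ≤⟨ ℚ.+-monoˡ-≤ (v ℚ.- u) (regular≤ y n m) ⟩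
  (seq y m ℚ.+ (u ℚ.+ v)) ℚ.+ (v ℚ.- u)                           ≡⟨ solve 3 (λ y u v → (y :+ (u :+ v)) :+ (v :- u) := y :+ (v :+ v)) refl (seq y m) u v ⟩
  seq y m ℚ.+ (v ℚ.+ v)                                           ∎
  where
  open ℚ.≤-Reasoning
  open +-*-Solver
  u = 1/1+ n
  v = 1/1+ m

-- At the witness index n the value of ε exceeds 2u. Passing to index m loses at most u + v, which
-- leaves u up to an error v.
0<ᴿ⇒1/1+≤ᴿ : ∀ {ε} → 0ᴿ <ᴿ ε → ∃[ k ] const (1/1+ k) ≤ᴿ ε
0<ᴿ⇒1/1+≤ᴿ {ε} (n , 0<ε) = n , λ m → let v = 1/1+ m in begin
  u                                         ≡⟨ solve 1 (λ u → u := (con 0ℚ :+ (u :+ u)) :- u) refl u ⟩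
  (0ℚ ℚ.+ (u ℚ.+ u)) ℚ.- u                  ≤⟨ ℚ.+-monoˡ-≤ (ℚ.- u) (ℚ.<⇒≤ 0<ε) ⟩
  seq ε n ℚ.- u                             ≤⟨ ℚ.+-monoˡ-≤ (ℚ.- u) (regular≤ ε n m) ⟩
  (seq ε m ℚ.+ (u ℚ.+ v)) ℚ.- u             ≡⟨ solve 3 (λ y u v → (y :+ (u :+ v)) :- u := y :+ v) refl (seq ε m) u v ⟩
  seq ε m ℚ.+ v                             ≡⟨ ℚ.+-identityʳ _ ⟨
  (seq ε m ℚ.+ v) ℚ.+ 0ℚ                    ≤⟨ ℚ.+-monoʳ-≤ (seq ε m ℚ.+ v) (ℚ.<⇒≤ (1/1+-pos m)) ⟩
  (seq ε m ℚ.+ v) ℚ.+ v                     ≡⟨ ℚ.+-assoc (seq ε m) v v ⟩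
  seq ε m ℚ.+ (v ℚ.+ v)                     ∎
  where
  open ℚ.≤-Reasoning
  open +-*-Solver
  u = 1/1+ n

-- Here u stands for the slack 2/(m+1) of the order on reals. Of the gap 4u, the two approximations
-- use u each, the margin in `_<ᴿ_` uses u, and the last u gives strictness.
separated⇒< : ∀ {x p q y u} → 0ℚ ℚ.< u →
  x ℚ.≤ p ℚ.+ u → p ℚ.+ ((u ℚ.+ u) ℚ.+ (u ℚ.+ u)) ℚ.≤ q → q ℚ.≤ y ℚ.+ u → x ℚ.+ u ℚ.< y
separated⇒< {x} {p} {q} {y} {u} 0<u x≤p+u p+4u≤q q≤y+u = begin-strict
  x ℚ.+ u                                           ≤⟨ ℚ.+-monoˡ-≤ u x≤p+u ⟩
  (p ℚ.+ u) ℚ.+ u                                   ≡⟨ ℚ.+-identityʳ _ ⟨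
  ((p ℚ.+ u) ℚ.+ u) ℚ.+ 0ℚ                          <⟨ ℚ.+-monoʳ-< ((p ℚ.+ u) ℚ.+ u) 0<u ⟩
  ((p ℚ.+ u) ℚ.+ u) ℚ.+ u                           ≡⟨ solve 2 (λ p u → ((p :+ u) :+ u) :+ u := (p :+ ((u :+ u) :+ (u :+ u))) :- u) refl p u ⟩
  (p ℚ.+ ((u ℚ.+ u) ℚ.+ (u ℚ.+ u))) ℚ.- u           ≤⟨ ℚ.+-monoˡ-≤ (ℚ.- u) (ℚ.≤-trans p+4u≤q q≤y+u) ⟩
  (y ℚ.+ u) ℚ.- u                                   ≡⟨ solve 2 (λ y u → (y :+ u) :- u := y) refl y u ⟩
  y                                                 ∎
  where
  open ℚ.≤-Reasoning
  open +-*-Solver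

halve : (P : ℚ → Set) → ∃[ k ] P (1/1+ k) → ∃[ k ] P ((1/1+ k) ℚ.+ (1/1+ k))
halve P (k , Pk) = half k , subst P (sym (1/1+-half k)) Pk

-- The gap 4u with u = 2/(m+1) equals 8/(m+1), hence three halvings.
archimedean-eighth : ∀ {p q} → p ℚ.< q →
  ∃[ m ] let u = (1/1+ m) ℚ.+ (1/1+ m) in p ℚ.+ ((u ℚ.+ u) ℚ.+ (u ℚ.+ u)) ℚ.≤ q
archimedean-eighth {p} {q} p<q =
  halve (λ w → p ℚ.+ ((w ℚ.+ w) ℚ.+ (w ℚ.+ w)) ℚ.≤ q)
 (halve (λ w → p ℚ.+ (w ℚ.+ w) ℚ.≤ q)
 (halve (λ w → p ℚ.+ w ℚ.≤ q) (archimedean p<q)))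

≤const<const≤⇒<ᴿ : ∀ {x y p q} → x ≤ᴿ const p → p ℚ.< q → const q ≤ᴿ y → x <ᴿ y
≤const<const≤⇒<ᴿ {x} {y} {p} {q} x≤p p<q q≤y = separate (archimedean-eighth p<q)
  where
  separate : (∃[ m ] let u = (1/1+ m) ℚ.+ (1/1+ m) in p ℚ.+ ((u ℚ.+ u) ℚ.+ (u ℚ.+ u)) ℚ.≤ q) → x <ᴿ y
  separate (m , p+4u≤q) =
    m , separated⇒< {seq x m} {p} {q} {seq y m} {(1/1+ m) ℚ.+ (1/1+ m)}
          (1/1+-double-pos m) (x≤p m) p+4u≤q (q≤y m)

0<ᴿconst : ∀ {q} → 0ℚ ℚ.< q → 0ᴿ <ᴿ const q
0<ᴿconst {q} 0<q =
  ≤const<const≤⇒<ᴿ {0ᴿ} {const q} {0ℚ} {q}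
    (const-mono {0ℚ} {0ℚ} ℚ.≤-refl) 0<q (const-mono {q} {q} ℚ.≤-refl)

-- Halving turns a non-strict bound into a strict one, so closed balls with radii 1/(k+1) can
-- replace open balls with real radii.
radius-below : ∀ {ε} → 0ᴿ <ᴿ ε → ∃[ k ] (∀ {x} → x ≤ᴿ const (1/1+ k) → x <ᴿ ε)
radius-below {ε} 0<ε = below (0<ᴿ⇒1/1+≤ᴿ {ε} 0<ε)
  where
  below : ∃[ k ] const (1/1+ k) ≤ᴿ ε → ∃[ k ] (∀ {x} → x ≤ᴿ const (1/1+ k) → x <ᴿ ε)
  below (k , 1/1+k≤ε) =
    half k , λ {x} x≤ → ≤const<const≤⇒<ᴿ {x} {ε} {1/1+ half k} {1/1+ k} x≤ (1/1+-half< k) 1/1+k≤ε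

-- Closed balls of radius 1/(k+1) and the Baire category theorem.

module CompletelyMetrizable {X : TopologicalSpace a} (metrizable : IsCompletelyMetrizable X) where
  open TopologicalSpace X
  open IsCompletelyMetrizable metrizable
  private module d = IsGeneralMetric isMetric

  -- Opaque, so that conversion checking never unfolds 1/1+_ into gcd computations on open terms.
  opaque
    Near : ℕ → Carrier → Carrier → Set
    Near k x y = d x y ≤ᴿ const (1/1+ k)

    near-refl : ∀ k x → Near k x x
    near-refl k x =
      d.trans {d x x} {0ᴿ} {const (1/1+ k)} (proj₁ (d.≈⇒0 d.EqC.refl))
        (d.trans {0ᴿ} {const 0ℚ} {const (1/1+ k)} (const-mono {0ℚ} {0ℚ} ℚ.≤-refl)
          (const-mono {0ℚ} {1/1+ k} (ℚ.<⇒≤ (1/1+-pos k))))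

    near-sym : ∀ {k x y} → Near k x y → Near k y x
    near-sym {k} {x} {y} = d.trans {d y x} {d x y} {const (1/1+ k)} (proj₁ (d.sym y x))

    near-mono : ∀ {j k x y} → j ℕ.≤ k → Near k x y → Near j x y
    near-mono {j} {k} {x} {y} j≤k xy =
      d.trans {d x y} {const (1/1+ k)} {const (1/1+ j)} xy
        (const-mono {1/1+ k} {1/1+ j} (1/1+-antitone j≤k))

    near-trans : ∀ {k x y z} → Near (half k) x y → Near (half k) y z → Near k x z
    near-trans {k} {x} {y} {z} xy yz =
      d.trans {d x z} {d x y +ᴿ d y z} {const (1/1+ k)} (d.triangle x y z)
        (subst (λ q → (d x y +ᴿ d y z) ≤ᴿ const q) (1/1+-half k)
          (+ᴿ-mono-const {d x y} {d y z} {1/1+ half k} {1/1+ half k} xy yz))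

    open⇒near : ∀ {U x} → Open U → x ∈ U → ∃[ k ] (∀ {y} → Near k x y → y ∈ U)
    open⇒near {U} {x} U-open x∈U =
      let ε , 0<ε , ball⊆U = Equivalence.to (induces U) U-open x x∈U
          k , below        = radius-below {ε} 0<ε
      in k , λ {y} xy → ball⊆U y (below {d x y} xy)

    near⇒open : ∀ {U : Pred Carrier a} → (∀ {x} → x ∈ U → ∃[ k ] (∀ {y} → Near k x y → y ∈ U)) → Open U
    near⇒open {U} nhds = Equivalence.from (induces U) λ x x∈U → let k , near⊆U = nhds x∈U in
      const (1/1+ k) , 0<ᴿconst {1/1+ k} (1/1+-pos k) ,
      λ y d<k → near⊆U (<ᴿ⇒≤ᴿ {d x y} {const (1/1+ k)} d<k)

    near-complete : ∀ (s : ℕ → Carrier) → (∀ k → ∃[ N ] (∀ m n → N ℕ.≤ m → N ℕ.≤ n → Near k (s m) (s n))) →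
                    ∃[ z ] (∀ k → ∃[ N ] (∀ n → N ℕ.≤ n → Near k (s n) z))
    near-complete s s-cauchy =
      let z , s→z = complete s λ ε 0<ε →
            let k , below = radius-below {ε} 0<ε
                N , near = s-cauchy k
            in N , λ m n N≤m N≤n → below {d (s m) (s n)} (near m n N≤m N≤n)
      in z , λ k →
        let N , near = s→z (const (1/1+ k)) (0<ᴿconst {1/1+ k} (1/1+-pos k))
        in N , λ n N≤n → <ᴿ⇒≤ᴿ {d (s n) z} {const (1/1+ k)} (near n N≤n)

  -- A closed ball need not be open. The points that have some ball inside it form an open set:
  -- halve that ball and apply the triangle inequality.
  near-interior : ∀ k x → x ∈ Interior (Near k x)
  near-interior k x = U , U-open , (k , λ xy → xy) , λ {z} (j , zw) → zw (near-refl j z)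
    where
    U : Pred Carrier a
    U z = ∃[ j ] (∀ {w} → Near j z w → Near k x w)
    U-open : Open U
    U-open = near⇒open λ (j , near⊆) → half j , λ zy → half j , λ yw → near⊆ (near-trans zy yw)

  module BaireCategory (N : ℕ → Pred Carrier a) (N-nwd : ∀ n → NowhereDense (N n)) where

    -- Radii are given by indices, and j ≥ n makes them tend to 0. Halving the old radius
    -- keeps the limit of the centres inside every ball.
    refine : ∀ n x k → ∃[ y ] ∃[ j ] n ℕ.≤ j ×
             (∀ {z} → Near j y z → Near (half k) x z × z ∉ N n)
    refine n x k
      with U , U-open , x∈U , U⊆ ← near-interior (half k) x
      with y , y∈U , W , W-open , y∈W , W⊆ ← N-nwd n U U-open (x , x∈U)
      with i , near⊆ ← open⇒near (Open-∩ U-open W-open) (y∈U , y∈W)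
      = y , i ⊔ n , ℕ.m≤n⊔m i n , λ yz →
        let z∈U , z∈W = near⊆ (near-mono (ℕ.m≤m⊔n i n) yz) in U⊆ z∈U , W⊆ z∈W

    module _ (x₀ : Carrier) (k₀ : ℕ) where

      ball : ℕ → Carrier × ℕ
      ball zero    = x₀ , k₀
      ball (suc n) = let x , k = ball n
                         y , j , _ = refine n x k in y , j

      centre : ℕ → Carrier
      centre n = proj₁ (ball n)

      radius : ℕ → ℕ
      radius n = proj₂ (ball n)

      -- Stage n of the refinement only makes the index of the next radius at least n, hence the
      -- shift by one.
      n≤radius : ∀ n → n ℕ.≤ suc (radius n)
      n≤radius zero    = ℕ.z≤n
      n≤radius (suc n) = s≤s (proj₁ (proj₂ (proj₂ (refine n (centre n) (radius n)))))

      shrink : ∀ n {z} → Near (radius (suc n)) (centre (suc n)) z →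
               Near (half (radius n)) (centre n) z × z ∉ N n
      shrink n = proj₂ (proj₂ (proj₂ (refine n (centre n) (radius n))))

      k≤half-k : ∀ k → k ℕ.≤ half k
      k≤half-k k = ℕ.m≤n⇒m≤1+n (ℕ.m≤m+n k k)

      ball-antitone : ∀ m i {z} → Near (radius (i ℕ.+ m)) (centre (i ℕ.+ m)) z →
                      Near (radius m) (centre m) z
      ball-antitone m zero    near = near
      ball-antitone m (suc i) near =
        ball-antitone m i (near-mono (k≤half-k _) (proj₁ (shrink (i ℕ.+ m) near)))

      -- All later centres lie in the ball of half the radius. The other half is reserved for the
      -- passage to the limit.
      centre-near : ∀ m i → Near (half (radius m)) (centre m) (centre (i ℕ.+ suc m))
      centre-near m i = proj₁ (shrink m (ball-antitone (suc m) i (near-refl _ _)))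

      centre-cauchy : ∀ k → ∃[ M ] (∀ m n → M ℕ.≤ m → M ℕ.≤ n → Near k (centre m) (centre n))
      centre-cauchy k = M , λ m n M≤m M≤n → near-trans (near-sym (near-M M≤m)) (near-M M≤n)
        where
        -- By `n≤radius` the ball at stage M then has index at least `half k`, so any two later
        -- centres are within 1/(k+1) of each other.
        M = suc (half k)
        near-M : ∀ {n} → M ℕ.≤ n → Near (half k) (centre M) (centre n)
        near-M {n} M≤n = near-mono (ℕ.s≤s⁻¹ (n≤radius M))
          (subst (λ n → Near (radius M) (centre M) (centre n)) (ℕ.m∸n+n≡m M≤n)
            (ball-antitone M (n ℕ.∸ M) (near-refl _ _)))

      baire-ball : ∃[ z ] Near k₀ x₀ z × (∀ n → z ∉ N n)
      baire-ball = z , z∈ball 0 , λ n → proj₂ (shrink n (z∈ball (suc n)))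
        where
        limit = near-complete centre centre-cauchy
        z = proj₁ limit
        z∈ball : ∀ m → Near (radius m) (centre m) z
        -- The stage `M ℕ.+ suc m` lies past m, where the centres are in the half ball, and past M,
        -- where they are within half the radius of the limit.
        z∈ball m = let M , near = proj₂ limit (half (radius m)) in
          near-trans (centre-near m M) (near (M ℕ.+ suc m) (ℕ.m≤m+n M (suc m)))

    baire : ∀ {U} → Open U → Satisfiable U → ∃[ z ] z ∈ U × (∀ n → z ∉ N n)
    baire U-open (x , x∈U) =
      let k , near⊆U = open⇒near U-open x∈U
          z , near , z∉N = baire-ball x k
      in z , near⊆U near , z∉N

-- Colliding shifts of a syndetic set, and distinct elements of an infinite set.

-- The first element not below m works: it is either the initial one or at most d above a
-- predecessor smaller than m. The induction drops initial elements below m.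
syndetic-covers : ∀ {k d} (e : Fin (suc k) → ℤ) →
  (∀ (i : Fin k) → e (Fin.suc i) ℤ.- e (inject₁ i) ℤ.≤ + d) →
  ∀ {m} → e Fin.zero ℤ.< m ℤ.+ + d → m ℤ.≤ e (fromℕ k) →
  ∃[ i ] m ℤ.≤ e i × e i ℤ.< m ℤ.+ + d
syndetic-covers {zero} e gaps e₀<m+d m≤last = Fin.zero , m≤last , e₀<m+d
syndetic-covers {suc k} {d} e gaps {m} e₀<m+d m≤last with m ℤ.≤? e Fin.zero
... | yes m≤e₀ = Fin.zero , m≤e₀ , e₀<m+d
... | no  m≰e₀ = map Fin.suc id (syndetic-covers (e ∘ Fin.suc) (gaps ∘ Fin.suc) e₁<m+d m≤last)
  where
  open ℤ.≤-Reasoning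
  i≡i-j+j : ∀ i j → i ≡ (i ℤ.- j) ℤ.+ j
  i≡i-j+j = ℤ-Ring.solve-∀
  e₁<m+d : e (Fin.suc Fin.zero) ℤ.< m ℤ.+ + d
  e₁<m+d = begin-strict
    e (Fin.suc Fin.zero)                                         ≡⟨ i≡i-j+j _ (e Fin.zero) ⟩
    (e (Fin.suc Fin.zero) ℤ.- e Fin.zero) ℤ.+ e Fin.zero         ≤⟨ ℤ.+-monoˡ-≤ (e Fin.zero) (gaps Fin.zero) ⟩
    + d ℤ.+ e Fin.zero                                           <⟨ ℤ.+-monoʳ-< (+ d) (ℤ.≰⇒> m≰e₀) ⟩
    + d ℤ.+ m                                                    ≡⟨ ℤ.+-comm (+ d) m ⟩
    m ℤ.+ + d                                                    ∎

bounded : ∀ {n} (h : Fin n → ℤ) → ∃[ B ] (∀ i → ℤ.∣ h i ∣ ℕ.≤ B)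
bounded {zero}  h = 0 , λ ()
bounded {suc n} h = let B , h≤B = bounded (h ∘ Fin.suc) in
  ℤ.∣ h Fin.zero ∣ ⊔ B , λ where
    Fin.zero    → ℕ.m≤m⊔n _ B
    (Fin.suc i) → ℕ.≤-trans (h≤B i) (ℕ.m≤n⊔m ℤ.∣ h Fin.zero ∣ B)

i≤+∣i∣ : ∀ i → i ℤ.≤ + ℤ.∣ i ∣
i≤+∣i∣ (+ _)      = ℤ.≤-refl
i≤+∣i∣ -[1+ _ ]   = ℤ.-≤+

-- Each window [e₀ + B - h i, e₀ + B - h i + d) meets F; the offsets of the d + 1 hits lie in [0, d),
-- so two of them agree.
module _ {d B : ℕ} (h : Fin (suc d) → ℤ) (∣h∣≤B : ∀ i → ℤ.∣ h i ∣ ℕ.≤ B) (1≤d : 1 ℕ.≤ d)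
  (F : FiniteSet) (F-syndetic : FiniteSet.Syndetic F d) (2B≤F : + (B ℕ.+ B) ℤ.≤ FiniteSet.length F) where

  open FiniteSet F
  open ℤ.≤-Reasoning

  private
    e₀ eₗ : ℤ
    e₀ = elem Fin.zero
    eₗ = elem (fromℕ size-1)

    -- The shift by B keeps every left end between e₀ and eₗ, because each h i is at most B in
    -- absolute value and F has length at least 2B.
    left : Fin (suc d) → ℤ
    left i = (e₀ ℤ.+ + B) ℤ.- h i

    e₀≤left : ∀ i → e₀ ℤ.≤ left i
    e₀≤left i = begin
      e₀                       ≡⟨ rearrange e₀ (h i) ⟩
      (e₀ ℤ.+ h i) ℤ.- h i     ≤⟨ ℤ.+-monoˡ-≤ (ℤ.- h i) (ℤ.+-monoʳ-≤ e₀
                                    (ℤ.≤-trans (i≤+∣i∣ (h i)) (ℤ.+≤+ (∣h∣≤B i)))) ⟩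
      left i                   ∎
      where
      rearrange : ∀ e h → e ≡ (e ℤ.+ h) ℤ.- h
      rearrange = ℤ-Ring.solve-∀

    left≤eₗ : ∀ i → left i ℤ.≤ eₗ
    left≤eₗ i = begin
      left i                   ≤⟨ ℤ.+-monoʳ-≤ (e₀ ℤ.+ + B) (ℤ.≤-trans (i≤+∣i∣ (ℤ.- h i))
                                    (ℤ.+≤+ (subst (ℕ._≤ B) (sym (ℤ.∣-i∣≡∣i∣ (h i))) (∣h∣≤B i)))) ⟩
      (e₀ ℤ.+ + B) ℤ.+ + B     ≡⟨ ℤ.+-assoc e₀ (+ B) (+ B) ⟩
      e₀ ℤ.+ + (B ℕ.+ B)       ≤⟨ ℤ.+-monoʳ-≤ e₀ 2B≤F ⟩
      e₀ ℤ.+ (eₗ ℤ.- e₀)       ≡⟨ rearrange e₀ eₗ ⟩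
      eₗ                       ∎
      where
      rearrange : ∀ e f → e ℤ.+ (f ℤ.- e) ≡ f
      rearrange = ℤ-Ring.solve-∀

    e₀<left+d : ∀ i → e₀ ℤ.< left i ℤ.+ + d
    e₀<left+d i = begin-strict
      e₀                       ≤⟨ e₀≤left i ⟩
      left i                   ≡⟨ ℤ.+-identityʳ (left i) ⟨
      left i ℤ.+ + 0           <⟨ ℤ.+-monoʳ-< (left i) (ℤ.+<+ 1≤d) ⟩
      left i ℤ.+ + d           ∎

    cover : ∀ i → ∃[ r ] left i ℤ.≤ elem r × elem r ℤ.< left i ℤ.+ + d
    cover i = syndetic-covers elem F-syndetic (e₀<left+d i) (left≤eₗ i)

    hit : Fin (suc d) → Fin (suc size-1)
    hit i = proj₁ (cover i)

    offset : Fin (suc d) → ℤ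
    offset i = elem (hit i) ℤ.- left i

    +∣offset∣≡offset : ∀ i → + ℤ.∣ offset i ∣ ≡ offset i
    +∣offset∣≡offset i = ℤ.0≤i⇒+∣i∣≡i (ℤ.i≤j⇒0≤j-i (proj₁ (proj₂ (cover i))))

    ∣offset∣<d : ∀ i → ℤ.∣ offset i ∣ ℕ.< d
    ∣offset∣<d i = ℤ.drop‿+<+ (begin-strict
      + ℤ.∣ offset i ∣                 ≡⟨ +∣offset∣≡offset i ⟩
      elem (hit i) ℤ.- left i          <⟨ ℤ.+-monoˡ-< (ℤ.- left i) (proj₂ (proj₂ (cover i))) ⟩
      (left i ℤ.+ + d) ℤ.- left i      ≡⟨ rearrange (left i) (+ d) ⟩
      + d                              ∎)
      where
      rearrange : ∀ t d → (t ℤ.+ d) ℤ.- t ≡ d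
      rearrange = ℤ-Ring.solve-∀

    -- Adding h i moves window i to the common window starting at e₀ + B, so the shifted hit depends
    -- only on its offset.
    elem+h≡offset : ∀ i → elem (hit i) ℤ.+ h i ≡ offset i ℤ.+ (e₀ ℤ.+ + B)
    elem+h≡offset i = rearrange (elem (hit i)) (h i) (e₀ ℤ.+ + B)
      where
      rearrange : ∀ e h c → e ℤ.+ h ≡ (e ℤ.- (c ℤ.- h)) ℤ.+ c
      rearrange = ℤ-Ring.solve-∀

    same-offset⇒collide : ∀ i j → ℤ.∣ offset i ∣ ≡ ℤ.∣ offset j ∣ →
                          elem (hit i) ℤ.+ h i ≡ elem (hit j) ℤ.+ h j
    same-offset⇒collide i j same =
      trans (elem+h≡offset i) (trans (cong (ℤ._+ (e₀ ℤ.+ + B)) offset≡) (sym (elem+h≡offset j)))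
      where
      offset≡ : offset i ≡ offset j
      offset≡ = trans (sym (+∣offset∣≡offset i)) (trans (cong +_ same) (+∣offset∣≡offset j))

  shifts-collide : ∃[ i ] ∃[ j ] i Fin.< j × (∃[ r ] ∃[ s ] elem r ℤ.+ h i ≡ elem s ℤ.+ h j)
  shifts-collide =
    let i , j , i<j , same = Fin.pigeonhole (ℕ.n<1+n d) (λ i → fromℕ< (∣offset∣<d i))
    in i , j , i<j , hit i , hit j ,
       same-offset⇒collide i j
         (Fin.fromℕ<-injective ℤ.∣ offset i ∣ ℤ.∣ offset j ∣ (∣offset∣<d i) (∣offset∣<d j) same)

-- `Infinite` only denies that a list contains H, so each new element is obtained under a double
-- negation.
infinite⇒injection : ∀ {H : Pred ℤ p} → Infinite H → ∀ n →
  ¬ ¬ (Σ[ h ∈ (Fin n → ℤ) ] (∀ i → h i ∈ H) × (∀ {i j} → h i ≡ h j → i ≡ j))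
infinite⇒injection {H = H} H-infinite zero    none = none ((λ ()) , (λ ()) , λ {i} → contradiction i λ ())
infinite⇒injection {H = H} H-infinite (suc n) none =
  infinite⇒injection H-infinite n λ (h , h∈H , h-inj) →
    -- If the choice could not be continued, every x in H would be among the values chosen so far.
    -- Decidable equality of integers makes list membership stable.
    H-infinite (List.tabulate h , λ {x} x∈H → decidable-stable (x ∈? List.tabulate h) λ x∉h →
      none (extend h x , (λ { Fin.zero → x∈H ; (Fin.suc i) → h∈H i }) , extend-inj h x h-inj x∉h))
  where
  extend : (Fin n → ℤ) → ℤ → Fin (suc n) → ℤ
  extend h x Fin.zero    = x
  extend h x (Fin.suc i) = h i
  extend-inj : ∀ h x → (∀ {i j} → h i ≡ h j → i ≡ j) → x List.∉ List.tabulate h →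
               ∀ {i j} → extend h x i ≡ extend h x j → i ≡ j
  extend-inj h x h-inj x∉h {Fin.zero}  {Fin.zero}  eq   = refl
  extend-inj h x h-inj x∉h {Fin.zero}  {Fin.suc j} refl = contradiction (∈-tabulate⁺ j) x∉h
  extend-inj h x h-inj x∉h {Fin.suc i} {Fin.zero}  refl = contradiction (∈-tabulate⁺ i) x∉h
  extend-inj h x h-inj x∉h {Fin.suc i} {Fin.suc j} eq   = cong Fin.suc (h-inj eq)

-- Nowhere dense and meager sets.

module _ (S : TopologicalSpace a) where
  open TopologicalSpace S renaming (refl to ≈-refl; sym to ≈-sym; trans to ≈-trans)

  -- Inside U an open set missing P is found first, and then a part of it missing Q.
  nowhereDense-∪ : ∀ {P Q : Pred Carrier a} → NowhereDense P → NowhereDense Q → NowhereDense (P ∪ Q)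
  nowhereDense-∪ P-nwd Q-nwd U U-open U-sat =
    let x , x∈U , V , V-open , x∈V , V⊆ = P-nwd U U-open U-sat
        y , (y∈U , y∈V) , W , W-open , y∈W , W⊆ = Q-nwd (U ∩ V) (Open-∩ U-open V-open) (x , x∈U , x∈V)
    in y , y∈U , V ∩ W , Open-∩ V-open W-open , (y∈V , y∈W) ,
       λ { (z∈V , z∈W) (inj₁ z∈P) → V⊆ z∈V z∈P ; (z∈V , z∈W) (inj₂ z∈Q) → W⊆ z∈W z∈Q }

  -- Since g inverts f, the set `g ⊢ U` is the image of U under f. A point found there is carried
  -- back into U by g.
  nowhereDense-preimage : ∀ {f g} {P : Pred Carrier p} → Continuous f → Continuous g →
    (∀ x → f (g x) ≈ x) → (∀ x → g (f x) ≈ x) → NowhereDense P → NowhereDense (f ⊢ P)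
  nowhereDense-preimage {f = f} {g} f-cont g-cont fg gf P-nwd U U-open (x , x∈U) =
    let y , gy∈U , W , W-open , y∈W , W⊆ =
          P-nwd (g ⊢ U) (g-cont U U-open) (f x , Open-resp U-open {x} {g (f x)} (≈-sym (gf x)) x∈U)
    in g y , gy∈U , f ⊢ W , f-cont W W-open , Open-resp W-open {y} {f (g y)} (≈-sym (fg y)) y∈W , λ fz∈W → W⊆ fz∈W

  -- If U were empty, A △ U would be A itself, and A would be meager.
  nonmeager⇒¬¬satisfiable : ∀ {A U : Pred Carrier a} → ¬ Meager A → Meager (A △ U) → ¬ ¬ Satisfiable U
  nonmeager⇒¬¬satisfiable {A} {U} A-nonmeager (N , N-nwd , △⊆N , N⊆△) U-empty =
    A-nonmeager (N , N-nwd , (λ x∈A → △⊆N (inj₁ (x∈A , λ x∈U → U-empty (_ , x∈U)))) , λ x∈N →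
      case N⊆△ x∈N of λ where
        (inj₁ (x∈A , _)) → x∈A
        (inj₂ (x∈U , _)) → contradiction (_ , x∈U) U-empty)

-- Meeting translates under the action.

module _ (X : PolishℤSpace a) where
  open PolishℤSpace X renaming (refl to ≈-refl; sym to ≈-sym; trans to ≈-trans)
  open CompletelyMetrizable (IsPolish.isCompletelyMetrizable isPolish) using (module BaireCategory)

  -- This replaces iterates of `T` and `T⁻¹` by the action, where exponents add.
  T^≈· : ∀ n x → T^ n x ≈ n · x
  T^≈· (+ zero)  x = ≈-sym (·-identity x)
  T^≈· (+ suc n) x = ≈-trans (·-cong 1ℤ (T^≈· (+ n) x)) (≈-sym (·-action 1ℤ (+ n) x))
  T^≈· -[1+ zero ]  x = ≈-refl
  T^≈· -[1+ suc n ] x = ≈-trans (·-cong -1ℤ (T^≈· -[1+ n ] x)) (≈-sym (·-action -1ℤ -[1+ n ] x))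

  ·-collect : ∀ {i j n} → i ℤ.+ j ≡ n → ∀ x → i · j · x ≈ n · x
  ·-collect {i} {j} refl x = ≈-sym (·-action i j x)

  ·-cancel : ∀ i j x → i ℤ.+ j ≡ 0ℤ → i · j · x ≈ x
  ·-cancel i j x i+j≡0 = ≈-trans (·-collect {i} i+j≡0 x) (·-identity x)

  nowhereDense-translate : ∀ {P : Pred Carrier p} n → NowhereDense P → NowhereDense ((n ·_) ⊢ P)
  nowhereDense-translate n = nowhereDense-preimage space {f = n ·_} {(ℤ.- n) ·_} (continuous n) (continuous (ℤ.- n))
    (λ x → ·-cancel n (ℤ.- n) x (ℤ.+-inverseʳ n)) (λ x → ·-cancel (ℤ.- n) n x (ℤ.+-inverseˡ n))

  -- The hypothesis of the theorem for a single set V.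
  SyndeticallyRecurrent : Pred Carrier a → Set a
  SyndeticallyRecurrent V =
    ∃[ d ] 1 ℕ.≤ d × (∀ (l : ℕ) → 1 ℕ.≤ l →
      Σ[ F ∈ FiniteSet ] (FiniteSet.Syndetic F d × + l ℤ.≤ FiniteSet.length F ×
        Satisfiable (⋂ (Fin (suc (FiniteSet.size-1 F))) (λ i → image (T^ (FiniteSet.elem F i)) V))))

  recurrent⇒translates-meet : ∀ {V} {H : Pred ℤ a} → SyndeticallyRecurrent V → Infinite H →
    ¬ ¬ (∃[ h ] ∃[ h′ ] h ∈ H × h′ ∈ H × h ≢ h′ × (∃[ v ] ∃[ w ] v ∈ V × w ∈ V × h · v ≈ h′ · w))
  recurrent⇒translates-meet (d , 1≤d , recurrent) H-infinite none =
    infinite⇒injection H-infinite (suc d) λ (h , h∈H , h-inj) →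
      let B , ∣h∣≤B                         = bounded h
          -- Length 2B suffices for the collision; the successor ensures l ≥ 1 even if B = 0.
          F , F-syndetic , l≤F , x , x∈⋂    = recurrent (suc (B ℕ.+ B)) (s≤s ℕ.z≤n)
          open FiniteSet F
          i , j , i<j , r , s , fᵣ+hᵢ≡fₛ+hⱼ =
            shifts-collide h ∣h∣≤B 1≤d F F-syndetic (ℤ.≤-trans (ℤ.+≤+ (ℕ.n≤1+n (B ℕ.+ B))) l≤F)
          v , v∈V , x≈fᵣv                   = x∈⋂ r
          w , w∈V , x≈fₛw                   = x∈⋂ s
          fᵣv≈fₛw = ≈-trans (≈-sym (≈-trans x≈fᵣv (T^≈· (elem r) v))) (≈-trans x≈fₛw (T^≈· (elem s) w))
      -- The roles of v and w cross over: x = fᵣ · v = fₛ · w and hᵢ - fₛ = hⱼ - fᵣ, so moving x by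
      -- this difference gives hᵢ · w = hⱼ · v.
      in none (h i , h j , h∈H i , h∈H j , (λ hᵢ≡hⱼ → Fin.<⇒≢ i<j (h-inj hᵢ≡hⱼ)) , w , v , w∈V , v∈V ,
           swap-translates {elem r} {elem s} {h i} {h j} fᵣ+hᵢ≡fₛ+hⱼ fᵣv≈fₛw)
    where
    swap-translates : ∀ {f g h k v w} → f ℤ.+ h ≡ g ℤ.+ k → f · v ≈ g · w → h · w ≈ k · v
    swap-translates {f} {g} {h} {k} {v} {w} f+h≡g+k fv≈gw =
      ≈-trans (≈-sym (·-collect {h ℤ.- g} (h-g+g≡h h g) w))
        (≈-trans (·-cong (h ℤ.- g) (≈-sym fv≈gw)) (·-collect {h ℤ.- g} h-g+f≡k v))
      where
      h-g+g≡h : ∀ h g → (h ℤ.- g) ℤ.+ g ≡ h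
      h-g+g≡h = ℤ-Ring.solve-∀
      h-g+f≡k : (h ℤ.- g) ℤ.+ f ≡ k
      h-g+f≡k = trans (rearrange h g f) (trans (cong (ℤ._- g) f+h≡g+k) (cancel g k))
        where
        rearrange : ∀ h g f → (h ℤ.- g) ℤ.+ f ≡ (f ℤ.+ h) ℤ.- g
        rearrange = ℤ-Ring.solve-∀
        cancel : ∀ g k → (g ℤ.+ k) ℤ.- g ≡ k
        cancel = ℤ-Ring.solve-∀

  -- Baire category: U ∩ c⁻¹U has a point z such that neither z nor c · z is in the meager set A △ U.
  translates-of-comeager-meet : ∀ {A U h h′ v w} → Open U → Meager (A △ U) →
    v ∈ U → w ∈ U → h · v ≈ h′ · w → ¬ Empty (image (T^ h) A ∩ image (T^ h′) A)
  translates-of-comeager-meet {A} {U} {h} {h′} {v} {w} U-open (N , N-nwd , △⊆N , _) v∈U w∈U hv≈h′w disjoint =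
    -- Avoiding every N n puts z and c · z in A up to double negation, and the goal is a
    -- contradiction.
    U∖A-avoided z∈U (λ n → z∉N n ∘ inj₁) λ z∈A →
    U∖A-avoided cz∈U (λ n → z∉N n ∘ inj₂) λ cz∈A →
    disjoint (T^ h′ z)
      ((c · z , cz∈A , ≈-trans (T^≈· h′ z) (≈-trans (≈-sym (·-collect {h} (h+c≡h′ h h′) z)) (≈-sym (T^≈· h (c · z))))) ,
       (z , z∈A , ≈-refl))
    where
    c = h′ ℤ.- h
    h+c≡h′ : ∀ h h′ → h ℤ.+ (h′ ℤ.- h) ≡ h′
    h+c≡h′ = ℤ-Ring.solve-∀
    -h+h′≡c : ∀ h h′ → ℤ.- h ℤ.+ h′ ≡ h′ ℤ.- h
    -h+h′≡c = ℤ-Ring.solve-∀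
    v≈cw : v ≈ c · w
    v≈cw = ≈-trans (≈-sym (·-cancel (ℤ.- h) h v (ℤ.+-inverseˡ h)))
      (≈-trans (·-cong (ℤ.- h) hv≈h′w) (·-collect {ℤ.- h} (-h+h′≡c h h′) w))
    generic : ∃[ z ] z ∈ U ∩ ((c ·_) ⊢ U) × (∀ n → z ∉ N n ∪ ((c ·_) ⊢ N n))
    generic = BaireCategory.baire (λ n → N n ∪ ((c ·_) ⊢ N n))
      (λ n → nowhereDense-∪ space (N-nwd n) (nowhereDense-translate c (N-nwd n)))
      -- The point w shows that the open set is nonempty, since c · w = v lies in U.
      (Open-∩ U-open (continuous c U U-open)) (w , w∈U , Open-resp U-open v≈cw v∈U)
    z     = proj₁ generic
    z∈U   = proj₁ (proj₁ (proj₂ generic))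
    cz∈U  = proj₂ (proj₁ (proj₂ generic))
    z∉N   = proj₂ (proj₂ generic)
    U∖A-avoided : ∀ {y} → y ∈ U → (∀ n → y ∉ N n) → ¬ ¬ (y ∈ A)
    U∖A-avoided y∈U y∉N y∉A = let n , y∈N = △⊆N (inj₂ (y∈U , y∉A)) in y∉N n y∈N

theorem11p7 : ∀ {a : Level} (X : PolishℤSpace a) → let open PolishℤSpace X in
    (∀ (V : Pred Carrier a) → Open V → Satisfiable V →
    ∃[ d ] 1 ℕ.≤ d × (∀ (l : ℕ) → 1 ℕ.≤ l →
    Σ[ F ∈ FiniteSet ] (FiniteSet.Syndetic F d × + l ℤ.≤ FiniteSet.length F ×
    Satisfiable (⋂ (Fin (suc (FiniteSet.size-1 F))) (λ i → image (T^ (FiniteSet.elem F i)) V))))) →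
    ¬ (Σ[ A ∈ Pred Carrier a ] (A Respects _≈_ × ¬ Meager A × BaireMeasurable A × WeaklyWandering A))
theorem11p7 X recurrent (A , _ , A-nonmeager , (U , U-open , A△U-meager) , H , H-infinite , wandering) =
  nonmeager⇒¬¬satisfiable (PolishℤSpace.space X) A-nonmeager A△U-meager λ U-satisfiable →
  recurrent⇒translates-meet X (recurrent U U-open U-satisfiable) H-infinite
    λ (h , h′ , h∈H , h′∈H , h≢h′ , v , w , v∈U , w∈U , hv≈h′w) →
  translates-of-comeager-meet X U-open A△U-meager v∈U w∈U hv≈h′w (wandering h h′ h∈H h′∈H h≢h′)
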